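{- Let $n \ge 3$. For each vertex $v$ of $P_2 \square C_n$, the domination value satisfies $DV(v) = 1$ if $n \equiv 0 \pmod 4$; $DV(v)=\frac{n+1}{2}$ if $n \equiv 1,3 \pmod 4$ and $n \ne 3$; $DV(v)=\left(\lceil \frac{n+1}{2}\rceil\right)^2$ if $n \equiv 2 \pmod 4$ and $n \ne 6$; $DV(v)=3$ if $n=3$; $DV(v)=17$ if $n=6$.
   Context: $P_2 \square C_n$ is the Cartesian product of the path on 2 vertices with the cycle on $n$ vertices: two copies of $C_n$ with vertices $x_1,\dots,x_n$ and $y_1,\dots,y_n$ (labeled cyclically) together with the edges $x_iy_i$, $1 \le i \le n$. A minimum dominating set of a graph $G$ is a set $D\subseteq V(G)$ of minimum cardinality such that every vertex not in $D$ is adjacent to a vertex of $D$. For $v \in V(G)$, the domination value $DV(v)$ is the number of minimum dominating sets of $G$ containing $v$. -}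

module Defs where

open import Data.Nat as ℕ using (ℕ; zero; suc; _+_; _≤_; _<_)
open import Data.Nat.Properties using (≮⇒≥; <⇒≱)
open import Data.Fin using (Fin; toℕ; splitAt)
open import Data.Fin.Subset using (Subset; inside; outside; _∈_; ∣_∣)
open import Data.Fin.Subset.Properties using (_∈?_; anySubset?)
open import Data.Fin.Properties using (all?; any?)
open import Data.Product using (Σ; ∃; _×_; _,_; proj₁; proj₂)
open import Data.Sum using (_⊎_; inj₁; inj₂)
open import Data.Empty using (⊥)
import Agda.Primitive
open import Relation.Nullary using (Dec; yes; no; ¬_)
open import Relation.Nullary.Decidable using (_×-dec_; _⊎-dec_; ¬?; map′)
open import Relation.Unary using (Pred; Decidable)
open import Relation.Binary.PropositionalEquality using (_≡_)

record Graph (m : ℕ) : Set₁ where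
  field
    Adj  : Fin m → Fin m → Set
    adj? : ∀ u v → Dec (Adj u v)

count : ∀ {m} {P : Pred (Subset m) Agda.Primitive.lzero} → Decidable P → ℕ
count {zero}  P? with P? Data.Vec.[] where import Data.Vec
... | yes _ = 1
... | no  _ = 0
count {suc m} P? = count (λ D → P? (inside Data.Vec.∷ D)) + count (λ D → P? (outside Data.Vec.∷ D))
  where import Data.Vec

module _ {m : ℕ} (G : Graph m) where
  open Graph G

  IsDominating : Subset m → Set
  IsDominating D = ∀ v → v ∈ D ⊎ ∃ λ u → u ∈ D × Adj u v

  IsMinDominating : Subset m → Set
  IsMinDominating D = IsDominating D × (∀ D′ → IsDominating D′ → ∣ D ∣ ≤ ∣ D′ ∣)

  isDominating? : ∀ D → Dec (IsDominating D)
  isDominating? D = all? (λ v → (v ∈? D) ⊎-dec any? (λ u → (u ∈? D) ×-dec adj? u v))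

  isMinDominating? : ∀ D → Dec (IsMinDominating D)
  isMinDominating? D = isDominating? D ×-dec
    map′ (λ ¬sm D′ d′ → ≮⇒≥ (λ lt → ¬sm (D′ , d′ , lt)))
         (λ h (D′ , d′ , lt) → <⇒≱ lt (h D′ d′))
         (¬? (anySubset? (λ D′ → isDominating? D′ ×-dec (∣ D′ ∣ ℕ.<? ∣ D ∣))))

  DV : Fin m → ℕ
  DV v = count (λ D → isMinDominating? D ×-dec (v ∈? D))

-- The prism P₂ □ Cₙ on vertex set Fin (n + n):
-- vertex k with toℕ k < n is x_{k}, vertex n + i is y_{i} (0-indexed, cyclic).

CycAdj : (n : ℕ) → Fin n → Fin n → Set
CycAdj n i j =  (suc (toℕ i) ≡ toℕ j) ⊎ (suc (toℕ j) ≡ toℕ i)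
             ⊎ (suc (toℕ i) ≡ n × toℕ j ≡ 0) ⊎ (suc (toℕ j) ≡ n × toℕ i ≡ 0)

cycAdj? : ∀ n i j → Dec (CycAdj n i j)
cycAdj? n i j = (suc (toℕ i) ℕ.≟ toℕ j) ⊎-dec (suc (toℕ j) ℕ.≟ toℕ i)
  ⊎-dec ((suc (toℕ i) ℕ.≟ n) ×-dec (toℕ j ℕ.≟ 0))
  ⊎-dec ((suc (toℕ j) ℕ.≟ n) ×-dec (toℕ i ℕ.≟ 0))

PrismAdj′ : (n : ℕ) → Fin n ⊎ Fin n → Fin n ⊎ Fin n → Set
PrismAdj′ n (inj₁ i) (inj₁ j) = CycAdj n i j
PrismAdj′ n (inj₂ i) (inj₂ j) = CycAdj n i j
PrismAdj′ n (inj₁ i) (inj₂ j) = i ≡ j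
PrismAdj′ n (inj₂ i) (inj₁ j) = i ≡ j

prismAdj′? : ∀ n a b → Dec (PrismAdj′ n a b)
prismAdj′? n (inj₁ i) (inj₁ j) = cycAdj? n i j
prismAdj′? n (inj₂ i) (inj₂ j) = cycAdj? n i j
prismAdj′? n (inj₁ i) (inj₂ j) = i Data.Fin.≟ j
prismAdj′? n (inj₂ i) (inj₁ j) = i Data.Fin.≟ j

P₂□C : (n : ℕ) → Graph (n + n)
P₂□C n = record
  { Adj  = λ u v → PrismAdj′ n (splitAt n u) (splitAt n v)
  ; adj? = λ u v → prismAdj′? n (splitAt n u) (splitAt n v)
  }

{-# OPTIONS --safe #-}
module Submission where

open import Defs
open import Data.Bool using (Bool; true; false; T; _∧_)
open import Data.Fin using (Fin; zero; suc; toℕ; fromℕ; fromℕ<; inject₁; splitAt; join)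
open import Data.Fin.Induction using (<-weakInduction)
open import Data.Fin.Properties using (toℕ-inject₁; toℕ-fromℕ; toℕ-fromℕ<; toℕ<n; splitAt-join)
open import Data.Fin.Subset using (Subset; _∈_; ∣_∣)
open import Data.Fin.Subset.Properties using (_∈?_)
open import Data.List using (List; []; _∷_)
import Data.List.Membership.Propositional as List
open import Data.List.Relation.Unary.Any using (here; there)
open import Data.Nat using (ℕ; zero; suc; _+_; _*_; _∸_; _≤_; _<_; _^_; _%_; _/_; _≡ᵇ_; _<?_; ⌈_/2⌉; z≤n; s≤s)
open import Data.Nat.Properties
open import Data.Nat.DivMod using (m≡m%n+[m/n]*n; m%n<n; [m+kn]%n≡m%n; m*n/n≡m)
open import Data.Nat.Tactic.RingSolver using (solve-∀)
open import Data.Product using (∃; _×_; _,_; proj₁; proj₂; swap)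
open import Data.Sum using (_⊎_; inj₁; inj₂; [_,_]′)
open import Data.Vec using (Vec; []; _∷_; _++_; _∷ʳ_; lookup; map; zip; take; drop)
open import Data.Vec.Properties using (lookup-splitAt; lookup-zip; lookup-map; take++drop≡id; []=⇒lookup; lookup⇒[]=)
open import Function using (_∘_)
open import Relation.Nullary using (¬_; Dec; yes; no; does; contradiction)
open import Relation.Nullary.Decidable using (_×-dec_)
open import Relation.Unary using (Pred; Decidable)
open import Relation.Binary.PropositionalEquality using (_≡_; _≢_; _≗_; refl; sym; trans; cong; cong₂; subst; subst₂; module ≡-Reasoning)

-- Read a subset of the prism as a cyclic word of columns. Every vertex dominates exactly four
-- vertices, so a dominating set D satisfies 4 |D| = 2 n + cost, where the cost is the total
-- over-domination, a sum of contributions of three consecutive columns. Minimum dominating sets are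
-- thus the cyclic words of least cost, which is 0, 2 or 4. By the rotations and the reflection of the
-- prism it suffices to count the words whose first column contains x₀, and this is done by a transfer
-- operator on pairs of columns. The relevant zero-cost walks have period 4, so along each residue
-- class modulo 4 the counts of cost at most 4 become polynomial of degree at most 2 in n; the
-- recurrence is checked by evaluation, with the initial values n ≤ 6 evaluated separately.

-- Sums over lists and over all vectors with entries in a list

sumOver : {A : Set} → List A → (A → ℕ) → ℕ
sumOver []       f = 0
sumOver (x ∷ xs) f = f x + sumOver xs f

sumVec : {A : Set} → List A → ∀ n → (Vec A n → ℕ) → ℕ
sumVec xs zero    f = f []
sumVec xs (suc n) f = sumOver xs λ a → sumVec xs n λ v → f (a ∷ v)

module _ {A : Set} where

  sumOver-cong : ∀ (xs : List A) {f g} → f ≗ g → sumOver xs f ≡ sumOver xs g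
  sumOver-cong []       eq = refl
  sumOver-cong (x ∷ xs) eq = cong₂ _+_ (eq x) (sumOver-cong xs eq)

  sumOver-zero : ∀ (xs : List A) → sumOver xs (λ _ → 0) ≡ 0
  sumOver-zero []       = refl
  sumOver-zero (x ∷ xs) = sumOver-zero xs

  sumOver-+ : ∀ (xs : List A) f g →
    sumOver xs (λ a → f a + g a) ≡ sumOver xs f + sumOver xs g
  sumOver-+ []       f g = refl
  sumOver-+ (x ∷ xs) f g =
    trans (cong (f x + g x +_) (sumOver-+ xs f g)) (interchange (f x) (g x) _ _)
    where
    interchange : ∀ a b c d → a + b + (c + d) ≡ a + c + (b + d)
    interchange = solve-∀

  sumOver-* : ∀ (xs : List A) k f → sumOver xs (λ a → k * f a) ≡ k * sumOver xs f
  sumOver-* []       k f = sym (*-zeroʳ k)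
  sumOver-* (x ∷ xs) k f =
    trans (cong (k * f x +_) (sumOver-* xs k f)) (sym (*-distribˡ-+ k (f x) _))

module _ {A B : Set} where

  sumOver-swap : ∀ (xs : List A) (ys : List B) (f : A → B → ℕ) →
    sumOver xs (λ a → sumOver ys (f a)) ≡ sumOver ys (λ b → sumOver xs λ a → f a b)
  sumOver-swap []       ys f = sym (sumOver-zero ys)
  sumOver-swap (x ∷ xs) ys f =
    trans (cong (sumOver ys (f x) +_) (sumOver-swap xs ys f)) (sym (sumOver-+ ys (f x) _))

module _ {A : Set} where

  sumOver-≡0 : ∀ {xs : List A} {f} → sumOver xs f ≡ 0 → ∀ {a} → a List.∈ xs → f a ≡ 0
  sumOver-≡0 {x ∷ xs} {f} eq (here refl) = m+n≡0⇒m≡0 (f x) eq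
  sumOver-≡0 {x ∷ xs} {f} eq (there a∈)  = sumOver-≡0 (m+n≡0⇒n≡0 (f x) eq) a∈

  sumOver-≢0 : ∀ (xs : List A) {f} → sumOver xs f ≢ 0 → ∃ λ a → f a ≢ 0
  sumOver-≢0 []           s≢0 = contradiction refl s≢0
  sumOver-≢0 (x ∷ xs) {f} s≢0 with f x in eq
  ... | suc _ = x , λ fx≡0 → contradiction (trans (sym eq) fx≡0) λ ()
  ... | zero  = sumOver-≢0 xs s≢0

  sumVec-cong : ∀ (xs : List A) n {f g} → f ≗ g → sumVec xs n f ≡ sumVec xs n g
  sumVec-cong xs zero    eq = eq []
  sumVec-cong xs (suc n) eq = sumOver-cong xs λ a → sumVec-cong xs n λ v → eq (a ∷ v)

  sumVec-* : ∀ (xs : List A) n k f → sumVec xs n (λ v → k * f v) ≡ k * sumVec xs n f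
  sumVec-* xs zero    k f = refl
  sumVec-* xs (suc n) k f =
    trans (sumOver-cong xs λ a → sumVec-* xs n k (f ∘ (a ∷_))) (sumOver-* xs k _)

  sumVec-≡0 : ∀ {xs : List A} → (∀ a → a List.∈ xs) → ∀ n {f} →
    sumVec xs n f ≡ 0 → ∀ v → f v ≡ 0
  sumVec-≡0 all zero    eq []      = eq
  sumVec-≡0 all (suc n) eq (a ∷ v) = sumVec-≡0 all n (sumOver-≡0 eq (all a)) v

  sumVec-≢0 : ∀ (xs : List A) n {f} → sumVec xs n f ≢ 0 → ∃ λ v → f v ≢ 0
  sumVec-≢0 xs zero    s≢0 = [] , s≢0
  sumVec-≢0 xs (suc n) s≢0 with sumOver-≢0 xs s≢0
  ... | a , t≢0 with sumVec-≢0 xs n t≢0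
  ... | v , fv≢0 = a ∷ v , fv≢0

  sumVec-swap : ∀ {B : Set} (xs : List A) n (ys : List B) (f : Vec A n → B → ℕ) →
    sumVec xs n (λ v → sumOver ys (f v)) ≡ sumOver ys (λ b → sumVec xs n λ v → f v b)
  sumVec-swap xs zero    ys f = refl
  sumVec-swap xs (suc n) ys f =
    trans (sumOver-cong xs λ a → sumVec-swap xs n ys (f ∘ (a ∷_))) (sumOver-swap xs ys λ a b → sumVec xs n λ v → f (a ∷ v) b)

  sumVec-++ : ∀ (xs : List A) m n f →
    sumVec xs (m + n) f ≡ sumVec xs m (λ u → sumVec xs n λ v → f (u ++ v))
  sumVec-++ xs zero    n f = refl
  sumVec-++ xs (suc m) n f = sumOver-cong xs λ a → sumVec-++ xs m n (f ∘ (a ∷_))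

  sumVec-∷ʳ : ∀ (xs : List A) n f →
    sumVec xs (suc n) f ≡ sumVec xs n (λ v → sumOver xs λ a → f (v ∷ʳ a))
  sumVec-∷ʳ xs zero    f = refl
  sumVec-∷ʳ xs (suc n) f = sumOver-cong xs λ a → sumVec-∷ʳ xs n (f ∘ (a ∷_))

rotate : {A : Set} {n : ℕ} → Vec A n → Vec A n
rotate []      = []
rotate (a ∷ v) = v ∷ʳ a

-- Splitting off the first letter on one side and the last letter on the other leaves the same
-- double sum with its two summations exchanged.
sumVec-rotate : ∀ {A : Set} (xs : List A) n f → sumVec xs n (f ∘ rotate) ≡ sumVec xs n f
sumVec-rotate xs zero    f = refl
sumVec-rotate xs (suc n) f =
  trans (sym (sumVec-swap xs n xs λ v a → f (v ∷ʳ a))) (sym (sumVec-∷ʳ xs n f))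

sumVec-map : ∀ {A : Set} (xs : List A) (π : A → A) →
  (∀ f → sumOver xs (f ∘ π) ≡ sumOver xs f) →
  ∀ n f → sumVec xs n (f ∘ map π) ≡ sumVec xs n f
sumVec-map xs π inv zero    f = refl
sumVec-map xs π inv (suc n) f =
  trans (sumOver-cong xs λ a → sumVec-map xs π inv n (f ∘ (π a ∷_)))
        (inv λ a → sumVec xs n (f ∘ (a ∷_)))

-- Words of columns

Column : Set
Column = Bool × Bool

bit : Bool → ℕ
bit true  = 1
bit false = 0

bools : List Bool
bools = true ∷ false ∷ []

columns : List Column
columns = (true , true) ∷ (true , false) ∷ (false , true) ∷ (false , false) ∷ []

∈-bools : ∀ b → b List.∈ bools
∈-bools true  = here refl
∈-bools false = there (here refl)

sumOver-columns : ∀ f → sumOver columns f ≡ sumOver bools λ x → sumOver bools λ y → f (x , y)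
sumOver-columns f = assoc (f (true , true)) (f (true , false)) (f (false , true)) (f (false , false))
  where
  assoc : ∀ a b c d → a + (b + (c + (d + 0))) ≡ a + (b + 0) + (c + (d + 0) + 0)
  assoc = solve-∀

sumOver-swapped : ∀ f → sumOver columns (f ∘ swap) ≡ sumOver columns f
sumOver-swapped f = comm (f (true , true)) (f (false , true)) (f (true , false)) _
  where
  comm : ∀ a b c d → a + (b + (c + d)) ≡ a + (c + (b + d))
  comm = solve-∀

-- A subset of the prism lists one whole row before the other, whereas a word goes column by column.
-- Moving each `y` past the remaining `X` passes from one order to the other.
sumVec-zip : ∀ n f →
  sumVec bools n (λ X → sumVec bools n λ Y → f (zip X Y)) ≡ sumVec columns n f
sumVec-zip zero    f = refl
sumVec-zip (suc n) f = begin
  (sumOver bools λ x → sumVec bools n λ X → sumOver bools λ y → sumVec bools n λ Y →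
    f ((x , y) ∷ zip X Y))
    ≡⟨ (sumOver-cong bools λ x → sumVec-swap bools n bools λ X y → sumVec bools n λ Y → f ((x , y) ∷ zip X Y)) ⟩
  (sumOver bools λ x → sumOver bools λ y → sumVec bools n λ X → sumVec bools n λ Y →
    f ((x , y) ∷ zip X Y))
    ≡⟨ (sumOver-cong bools λ x → sumOver-cong bools λ y → sumVec-zip n (f ∘ ((x , y) ∷_))) ⟩
  (sumOver bools λ x → sumOver bools λ y → sumVec columns n λ w → f ((x , y) ∷ w))
    ≡⟨ sym (sumOver-columns λ a → sumVec columns n (f ∘ (a ∷_))) ⟩
  sumVec columns (suc n) f ∎
  where open ≡-Reasoning

count≡sumVec : ∀ {m} {P : Pred (Subset m) _} (P? : Decidable P) →
  count P? ≡ sumVec bools m λ D → bit (does (P? D))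
count≡sumVec {zero} P? with P? []
... | yes _ = refl
... | no  _ = refl
count≡sumVec {suc m} P? =
  cong₂ _+_ (count≡sumVec λ D → P? (true ∷ D))
            (trans (count≡sumVec λ D → P? (false ∷ D)) (sym (+-identityʳ _)))

-- Windows of a word w, preceded by the letter a and followed by the letter z

headOr : {A : Set} {n : ℕ} → Vec A n → A → A
headOr []      z = z
headOr (b ∷ _) z = b

lastOr : {A : Set} {n : ℕ} → A → Vec A n → A
lastOr a []      = a
lastOr a (b ∷ w) = lastOr b w

before : {A : Set} {n : ℕ} → A → Vec A n → Fin n → A
before a (b ∷ w) zero    = a
before a (b ∷ w) (suc i) = before b w i

after : {A : Set} {n : ℕ} → Vec A n → A → Fin n → A
after (b ∷ w) z zero    = headOr w z
after (b ∷ w) z (suc i) = after w z i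

-- The letters `a` and `z` occur in windows, but no window is centred at them.
walk : {A : Set} {n : ℕ} → (A → A → A → ℕ) → A → Vec A n → A → ℕ
walk h a []      z = 0
walk h a (b ∷ w) z = h a b (headOr w z) + walk h b w z

module _ {A : Set} where

  lookup-before : ∀ {n} a (w : Vec A n) i j → suc (toℕ j) ≡ toℕ i → lookup w j ≡ before a w i
  lookup-before a (b ∷ c ∷ w) (suc zero)    zero    eq = refl
  lookup-before a (b ∷ w)     (suc i)       (suc j) eq = lookup-before b w i j (suc-injective eq)

  lookup-after : ∀ {n} (w : Vec A n) z i j → suc (toℕ i) ≡ toℕ j → lookup w j ≡ after w z i
  lookup-after (b ∷ c ∷ w) z zero    (suc zero) eq = refl
  lookup-after (b ∷ w)     z (suc i) (suc j)    eq = lookup-after w z i j (suc-injective eq)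

  lookup-last : ∀ {n} a (w : Vec A n) j → suc (toℕ j) ≡ n → lookup w j ≡ lastOr a w
  lookup-last a (b ∷ [])    zero    eq = refl
  lookup-last a (b ∷ c ∷ w) (suc j) eq = lookup-last b (c ∷ w) j (suc-injective eq)

  after-last : ∀ {n} (w : Vec A n) z i → suc (toℕ i) ≡ n → after w z i ≡ z
  after-last (b ∷ [])    z zero    eq = refl
  after-last (b ∷ c ∷ w) z (suc i) eq = after-last (c ∷ w) z i (suc-injective eq)

  headOr-∷ʳ : ∀ {n} (w : Vec A n) c z → headOr (w ∷ʳ c) z ≡ headOr w c
  headOr-∷ʳ []      c z = refl
  headOr-∷ʳ (b ∷ w) c z = refl

  lastOr-∷ʳ : ∀ {n} a (w : Vec A n) c → lastOr a (w ∷ʳ c) ≡ c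
  lastOr-∷ʳ a []      c = refl
  lastOr-∷ʳ a (b ∷ w) c = lastOr-∷ʳ b w c

  lookup-∷ʳ : ∀ {n} (w : Vec A n) c i → lookup (w ∷ʳ c) (inject₁ i) ≡ lookup w i
  lookup-∷ʳ (b ∷ w) c zero    = refl
  lookup-∷ʳ (b ∷ w) c (suc i) = lookup-∷ʳ w c i

  walk-∷ʳ : ∀ {n} h a (w : Vec A n) c z →
    walk h a (w ∷ʳ c) z ≡ walk h a w c + h (lastOr a w) c z
  walk-∷ʳ h a []      c z = +-identityʳ _
  walk-∷ʳ h a (b ∷ w) c z = begin
    h a b (headOr (w ∷ʳ c) z) + walk h b (w ∷ʳ c) z
      ≡⟨ cong₂ _+_ (cong (h a b) (headOr-∷ʳ w c z)) (walk-∷ʳ h b w c z) ⟩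
    h a b (headOr w c) + (walk h b w c + h (lastOr b w) c z)
      ≡⟨ sym (+-assoc (h a b (headOr w c)) _ _) ⟩
    h a b (headOr w c) + walk h b w c + h (lastOr b w) c z ∎
    where open ≡-Reasoning

  walk-map : ∀ {n} h (π : A → A) → (∀ a b c → h (π a) (π b) (π c) ≡ h a b c) →
    ∀ a (w : Vec A n) z → walk h (π a) (map π w) (π z) ≡ walk h a w z
  walk-map h π inv a []          z = refl
  walk-map h π inv a (b ∷ [])    z = cong (_+ 0) (inv a b z)
  walk-map h π inv a (b ∷ c ∷ w) z = cong₂ _+_ (inv a b c) (walk-map h π inv b (c ∷ w) z)

  lastOr-map : ∀ {n} (π : A → A) a (w : Vec A n) → lastOr (π a) (map π w) ≡ π (lastOr a w)
  lastOr-map π a []      = refl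
  lastOr-map π a (b ∷ w) = lastOr-map π b w

cyclic : {A : Set} {n : ℕ} → (A → A → A → ℕ) → Vec A (suc n) → ℕ
cyclic h (c ∷ w) = walk h (lastOr c w) (c ∷ w) c

prev next : {A : Set} {n : ℕ} → Vec A (suc n) → Fin (suc n) → A
prev (c ∷ w) = before (lastOr c w) (c ∷ w)
next (c ∷ w) = after (c ∷ w) c

module _ {A : Set} where

  -- The window centred at the first letter becomes the one centred at the last; the others keep
  -- their order.
  cyclic-rotate : ∀ {n} h (w : Vec A (suc n)) → cyclic h (rotate w) ≡ cyclic h w
  cyclic-rotate h (c ∷ [])    = refl
  cyclic-rotate h (c ∷ d ∷ w) = begin
    walk h (lastOr d (w ∷ʳ c)) (d ∷ (w ∷ʳ c)) d ≡⟨ cong (λ a → walk h a (d ∷ (w ∷ʳ c)) d) (lastOr-∷ʳ d w c) ⟩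
    walk h c (d ∷ (w ∷ʳ c)) d                   ≡⟨ walk-∷ʳ h c (d ∷ w) c d ⟩
    walk h c (d ∷ w) c + h (lastOr d w) c d   ≡⟨ +-comm (walk h c (d ∷ w) c) _ ⟩
    h (lastOr d w) c d + walk h c (d ∷ w) c   ∎
    where open ≡-Reasoning

  cyclic-map : ∀ {n} h (π : A → A) → (∀ a b c → h (π a) (π b) (π c) ≡ h a b c) →
    ∀ (w : Vec A (suc n)) → cyclic h (map π w) ≡ cyclic h w
  cyclic-map h π inv (c ∷ w) =
    trans (cong (λ a → walk h a (map π (c ∷ w)) (π c)) (lastOr-map π c w))
          (walk-map h π inv (lastOr c w) (c ∷ w) c)

  adjacent⇒prev⊎next : ∀ {n} (w : Vec A (suc n)) i j → CycAdj (suc n) j i →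
    lookup w j ≡ prev w i ⊎ lookup w j ≡ next w i
  adjacent⇒prev⊎next (c ∷ w) i j (inj₁ eq) = inj₁ (lookup-before _ (c ∷ w) i j eq)
  adjacent⇒prev⊎next (c ∷ w) i j (inj₂ (inj₁ eq)) = inj₂ (lookup-after (c ∷ w) c i j eq)
  -- The edge that wraps around: `j` is the last position and `i` the first. The next clause is the
  -- same edge read backwards.
  adjacent⇒prev⊎next (c ∷ w) zero j (inj₂ (inj₂ (inj₁ (eq , _)))) = inj₁ (lookup-last c (c ∷ w) j eq)
  adjacent⇒prev⊎next (c ∷ w) i zero (inj₂ (inj₂ (inj₂ (eq , _)))) = inj₂ (sym (after-last (c ∷ w) c i eq))

  prev-adjacent : ∀ {n} (w : Vec A (suc n)) i → ∃ λ j → CycAdj (suc n) j i × lookup w j ≡ prev w i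
  prev-adjacent {n} (c ∷ w) zero =
    fromℕ n , inj₂ (inj₂ (inj₁ (last , refl))) , lookup-last c (c ∷ w) (fromℕ n) last
    where
    last : suc (toℕ (fromℕ n)) ≡ suc n
    last = cong suc (toℕ-fromℕ n)
  prev-adjacent (c ∷ w) (suc i) =
    inject₁ i , inj₁ pred , lookup-before (lastOr c w) (c ∷ w) (suc i) (inject₁ i) pred
    where
    pred : suc (toℕ (inject₁ i)) ≡ toℕ (suc i)
    pred = cong suc (toℕ-inject₁ i)

  next-adjacent : ∀ {n} (w : Vec A (suc n)) i → ∃ λ j → CycAdj (suc n) j i × lookup w j ≡ next w i
  next-adjacent {n} (c ∷ w) i with suc (toℕ i) <? suc n
  ... | yes i+1<n = j , inj₂ (inj₁ succ) , lookup-after (c ∷ w) c i j succ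
    where
    j = fromℕ< i+1<n
    succ : suc (toℕ i) ≡ toℕ j
    succ = sym (toℕ-fromℕ< i+1<n)
  ... | no i+1≮n = zero , inj₂ (inj₂ (inj₂ (last , refl))) , sym (after-last (c ∷ w) c i last)
    where
    last : suc (toℕ i) ≡ suc n
    last = ≤-antisym (toℕ<n i) (≮⇒≥ i+1≮n)

-- Over-domination

neighbours : Bool → Bool → Bool → Bool → ℕ
neighbours p q r s = bit p + bit q + bit r + bit s

-- The size of the trace of the set on a closed neighbourhood: the two neighbours in the row, the
-- vertex itself in column `b`, and its partner in the other row.
row₁ row₂ : Column → Column → Column → ℕ
row₁ a b c = neighbours (proj₁ a) (proj₁ b) (proj₁ c) (proj₂ b)
row₂ a b c = row₁ (swap a) (swap b) (swap c)

-- A vertex with no dominator is charged 5, so that a total of at most 4 forces domination.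
surplus : ℕ → ℕ
surplus zero    = 5
surplus (suc k) = k

cost degree : Column → Column → Column → ℕ
cost   a b c = surplus (row₁ a b c) + surplus (row₂ a b c)
degree a b c = row₁ a b c + row₂ a b c

value : ∀ {n} → Vec Column n → Fin n ⊎ Fin n → Bool
value w (inj₁ i) = proj₁ (lookup w i)
value w (inj₂ i) = proj₂ (lookup w i)

dominators : ∀ {n} → Vec Column (suc n) → Fin (suc n) ⊎ Fin (suc n) → ℕ
dominators w (inj₁ i) = row₁ (prev w i) (lookup w i) (next w i)
dominators w (inj₂ i) = row₂ (prev w i) (lookup w i) (next w i)

Covered : ∀ {n} → Vec Column n → Fin n ⊎ Fin n → Set
Covered {n} w s = value w s ≡ true ⊎ ∃ λ t → value w t ≡ true × PrismAdj′ n t s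

neighbours-pos : ∀ p q r s →
  p ≡ true ⊎ q ≡ true ⊎ r ≡ true ⊎ s ≡ true → 1 ≤ neighbours p q r s
neighbours-pos true  q     r     s     _ = s≤s z≤n
neighbours-pos false true  r     s     _ = s≤s z≤n
neighbours-pos false false true  s     _ = s≤s z≤n
neighbours-pos false false false true  _ = s≤s z≤n
neighbours-pos false false false false (inj₂ (inj₂ (inj₂ ())))

neighbours-pos⁻¹ : ∀ p q r s → 1 ≤ neighbours p q r s →
  p ≡ true ⊎ q ≡ true ⊎ r ≡ true ⊎ s ≡ true
neighbours-pos⁻¹ true  q     r     s    _ = inj₁ refl
neighbours-pos⁻¹ false true  r     s    _ = inj₂ (inj₁ refl)
neighbours-pos⁻¹ false false true  s    _ = inj₂ (inj₂ (inj₁ refl))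
neighbours-pos⁻¹ false false false true _ = inj₂ (inj₂ (inj₂ refl))

covered⇒dominated : ∀ {n} (w : Vec Column (suc n)) s → Covered w s → 1 ≤ dominators w s
covered⇒dominated w (inj₁ i) cov = neighbours-pos _ _ _ _ (split cov)
  where
  split : Covered w (inj₁ i) → proj₁ (prev w i) ≡ true ⊎ proj₁ (lookup w i) ≡ true
    ⊎ proj₁ (next w i) ≡ true ⊎ proj₂ (lookup w i) ≡ true
  split (inj₁ eq) = inj₂ (inj₁ eq)
  split (inj₂ (inj₂ .i , eq , refl)) = inj₂ (inj₂ (inj₂ eq))
  split (inj₂ (inj₁ j , eq , adj)) with adjacent⇒prev⊎next w i j adj
  ... | inj₁ p = inj₁ (trans (cong proj₁ (sym p)) eq)
  ... | inj₂ p = inj₂ (inj₂ (inj₁ (trans (cong proj₁ (sym p)) eq)))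
covered⇒dominated w (inj₂ i) cov = neighbours-pos _ _ _ _ (split cov)
  where
  split : Covered w (inj₂ i) → proj₂ (prev w i) ≡ true ⊎ proj₂ (lookup w i) ≡ true
    ⊎ proj₂ (next w i) ≡ true ⊎ proj₁ (lookup w i) ≡ true
  split (inj₁ eq) = inj₂ (inj₁ eq)
  split (inj₂ (inj₁ .i , eq , refl)) = inj₂ (inj₂ (inj₂ eq))
  split (inj₂ (inj₂ j , eq , adj)) with adjacent⇒prev⊎next w i j adj
  ... | inj₁ p = inj₁ (trans (cong proj₂ (sym p)) eq)
  ... | inj₂ p = inj₂ (inj₂ (inj₁ (trans (cong proj₂ (sym p)) eq)))

dominated⇒covered : ∀ {n} (w : Vec Column (suc n)) s → 1 ≤ dominators w s → Covered w s
dominated⇒covered w (inj₁ i) pos with neighbours-pos⁻¹ _ _ _ _ pos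
... | inj₂ (inj₁ eq) = inj₁ eq
... | inj₂ (inj₂ (inj₂ eq)) = inj₂ (inj₂ i , eq , refl)
... | inj₁ eq =
  let j , adj , p = prev-adjacent w i in inj₂ (inj₁ j , trans (cong proj₁ p) eq , adj)
... | inj₂ (inj₂ (inj₁ eq)) =
  let j , adj , p = next-adjacent w i in inj₂ (inj₁ j , trans (cong proj₁ p) eq , adj)
dominated⇒covered w (inj₂ i) pos with neighbours-pos⁻¹ _ _ _ _ pos
... | inj₂ (inj₁ eq) = inj₁ eq
... | inj₂ (inj₂ (inj₂ eq)) = inj₂ (inj₁ i , eq , refl)
... | inj₁ eq =
  let j , adj , p = prev-adjacent w i in inj₂ (inj₂ j , trans (cong proj₂ p) eq , adj)
... | inj₂ (inj₂ (inj₁ eq)) =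
  let j , adj , p = next-adjacent w i in inj₂ (inj₂ j , trans (cong proj₂ p) eq , adj)

surplus-suc : ∀ {k} → 1 ≤ k → suc (surplus k) ≡ k
surplus-suc (s≤s _) = refl

surplus≤4 : ∀ {k} → surplus k ≤ 4 → 1 ≤ k
surplus≤4 {zero}  (s≤s (s≤s (s≤s (s≤s ()))))
surplus≤4 {suc k} _ = s≤s z≤n

walk-cost≤4 : ∀ {n} a (w : Vec Column n) z → walk cost a w z ≤ 4 → ∀ i →
  1 ≤ row₁ (before a w i) (lookup w i) (after w z i) × 1 ≤ row₂ (before a w i) (lookup w i) (after w z i)
walk-cost≤4 a (b ∷ w) z le zero =
  surplus≤4 (≤-trans (m≤m+n _ _) cost≤4) , surplus≤4 (≤-trans (m≤n+m _ (surplus (row₁ a b (headOr w z)))) cost≤4)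
  where
  cost≤4 : cost a b (headOr w z) ≤ 4
  cost≤4 = ≤-trans (m≤m+n _ _) le
walk-cost≤4 a (b ∷ w) z le (suc i) =
  walk-cost≤4 b w z (≤-trans (m≤n+m _ (cost a b (headOr w z))) le) i

cyclic-cost≤4⇒dominated : ∀ {n} (w : Vec Column (suc n)) → cyclic cost w ≤ 4 → ∀ s → 1 ≤ dominators w s
cyclic-cost≤4⇒dominated (c ∷ w) le (inj₁ i) = proj₁ (walk-cost≤4 (lastOr c w) (c ∷ w) c le i)
cyclic-cost≤4⇒dominated (c ∷ w) le (inj₂ i) = proj₂ (walk-cost≤4 (lastOr c w) (c ∷ w) c le i)

-- Each column holds two vertices, and a dominated vertex has one dominator more than its surplus.
walk-degree≡walk-cost : ∀ {n} a (w : Vec Column n) z →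
  (∀ i → 1 ≤ row₁ (before a w i) (lookup w i) (after w z i)) →
  (∀ i → 1 ≤ row₂ (before a w i) (lookup w i) (after w z i)) →
  walk degree a w z ≡ 2 * n + walk cost a w z
walk-degree≡walk-cost a []      z _ _ = refl
walk-degree≡walk-cost {suc n} a (b ∷ w) z pos₁ pos₂ = begin
  row₁ a b d + row₂ a b d + walk degree b w z
    ≡⟨ cong₂ _+_ (cong₂ _+_ (sym (surplus-suc (pos₁ zero))) (sym (surplus-suc (pos₂ zero))))
                 (walk-degree≡walk-cost b w z (pos₁ ∘ suc) (pos₂ ∘ suc)) ⟩
  suc (surplus (row₁ a b d)) + suc (surplus (row₂ a b d)) + (2 * n + walk cost b w z)
    ≡⟨ regroup (surplus (row₁ a b d)) _ n _ ⟩
  2 * suc n + (cost a b d + walk cost b w z) ∎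
  where
  open ≡-Reasoning
  d = headOr w z
  regroup : ∀ p q n r → suc p + suc q + (2 * n + r) ≡ 2 * suc n + (p + q + r)
  regroup = solve-∀

weight : Column → ℕ
weight (x , y) = bit x + bit y

size : ∀ {n} → Vec Column n → ℕ
size []      = 0
size (b ∷ w) = weight b + size w

-- A column counts twice in its own window and once in each neighbouring one, four times in all. The
-- remaining terms correct the ends: the first and last letters of a nonempty `w` each miss one
-- window, while `a` and `z` each enter one.
walk-degree≡size : ∀ {n} a (w : Vec Column n) z →
  walk degree a w z + weight (headOr w z) + weight (lastOr a w) ≡ weight a + weight z + 4 * size w
walk-degree≡size a []      z = trans (+-comm (weight z) _) (sym (+-identityʳ _))
walk-degree≡size a (b ∷ w) z = begin
  degree a b d + walk degree b w z + weight b + weight (lastOr b w)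
    ≡⟨ regroup₁ (bit (proj₁ a)) (bit (proj₂ a)) (bit (proj₁ b)) (bit (proj₂ b))
                (bit (proj₁ d)) (bit (proj₂ d)) _ _ ⟩
  weight a + 3 * weight b + (walk degree b w z + weight d + weight (lastOr b w))
    ≡⟨ cong (weight a + 3 * weight b +_) (walk-degree≡size b w z) ⟩
  weight a + 3 * weight b + (weight b + weight z + 4 * size w)
    ≡⟨ regroup₂ (weight a) (weight b) (weight z) (size w) ⟩
  weight a + weight z + 4 * (weight b + size w) ∎
  where
  open ≡-Reasoning
  d = headOr w z
  regroup₁ : ∀ a₁ a₂ b₁ b₂ d₁ d₂ r l →
    a₁ + b₁ + d₁ + b₂ + (a₂ + b₂ + d₂ + b₁) + r + (b₁ + b₂) + l
    ≡ a₁ + a₂ + 3 * (b₁ + b₂) + (r + (d₁ + d₂) + l)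
  regroup₁ = solve-∀
  regroup₂ : ∀ a b z s → a + 3 * b + (b + z + 4 * s) ≡ a + z + 4 * (b + s)
  regroup₂ = solve-∀

-- Every vertex dominates exactly four vertices.
4*size≡2*n+cyclic-cost : ∀ {n} (w : Vec Column (suc n)) → (∀ s → 1 ≤ dominators w s) →
  4 * size w ≡ 2 * suc n + cyclic cost w
4*size≡2*n+cyclic-cost {n} (c ∷ w) pos = begin
  4 * size (c ∷ w)                     ≡⟨ sym (+-cancelʳ-≡ (weight c + weight l) _ (4 * size (c ∷ w)) count-degrees) ⟩
  walk degree l (c ∷ w) c              ≡⟨ walk-degree≡walk-cost l (c ∷ w) c (pos ∘ inj₁) (pos ∘ inj₂) ⟩
  2 * suc n + walk cost l (c ∷ w) c    ∎
  where
  open ≡-Reasoning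
  l = lastOr c w
  -- With `l` and `c` as boundary letters of `c ∷ w`, the end corrections on the two sides agree.
  count-degrees : walk degree l (c ∷ w) c + (weight c + weight l) ≡ 4 * size (c ∷ w) + (weight c + weight l)
  count-degrees = begin
    walk degree l (c ∷ w) c + (weight c + weight l) ≡⟨ sym (+-assoc (walk degree l (c ∷ w) c) (weight c) (weight l)) ⟩
    walk degree l (c ∷ w) c + weight c + weight l   ≡⟨ walk-degree≡size l (c ∷ w) c ⟩
    weight l + weight c + 4 * size (c ∷ w)          ≡⟨ +-comm (weight l + weight c) _ ⟩
    4 * size (c ∷ w) + (weight l + weight c)        ≡⟨ cong (4 * size (c ∷ w) +_) (+-comm (weight l) _) ⟩
    4 * size (c ∷ w) + (weight c + weight l)        ∎

-- Subsets of the prism as words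

word : ∀ n → Subset (n + n) → Vec Column n
word n D = zip (take n D) (drop n D)

take-++ : ∀ {A : Set} {m n} (xs : Vec A m) (ys : Vec A n) → take m (xs ++ ys) ≡ xs
take-++ []       ys = refl
take-++ (x ∷ xs) ys = cong (x ∷_) (take-++ xs ys)

drop-++ : ∀ {A : Set} {m n} (xs : Vec A m) (ys : Vec A n) → drop m (xs ++ ys) ≡ ys
drop-++ []       ys = refl
drop-++ (x ∷ xs) ys = drop-++ xs ys

word-++ : ∀ {n} (X Y : Subset n) → word n (X ++ Y) ≡ zip X Y
word-++ X Y = cong₂ zip (take-++ X Y) (drop-++ X Y)

lookup≡value : ∀ n (D : Subset (n + n)) v → lookup D v ≡ value (word n D) (splitAt n v)
lookup≡value n D v = trans (cong (λ D → lookup D v) (sym (take++drop≡id n D)))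
  (trans (lookup-splitAt n (take n D) (drop n D) v) (by-row (splitAt n v)))
  where
  by-row : ∀ s → [ lookup (take n D) , lookup (drop n D) ]′ s ≡ value (word n D) s
  by-row (inj₁ i) = sym (cong proj₁ (lookup-zip i (take n D) (drop n D)))
  by-row (inj₂ i) = sym (cong proj₂ (lookup-zip i (take n D) (drop n D)))

∣∷∣ : ∀ {n} x (X : Subset n) → ∣ x ∷ X ∣ ≡ bit x + ∣ X ∣
∣∷∣ true  X = refl
∣∷∣ false X = refl

∣++∣ : ∀ {m n} (X : Subset m) (Y : Subset n) → ∣ X ++ Y ∣ ≡ ∣ X ∣ + ∣ Y ∣
∣++∣ []          Y = refl
∣++∣ (true  ∷ X) Y = cong suc (∣++∣ X Y)
∣++∣ (false ∷ X) Y = ∣++∣ X Y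

size-zip : ∀ {n} (X Y : Subset n) → size (zip X Y) ≡ ∣ X ∣ + ∣ Y ∣
size-zip []      []      = refl
size-zip (x ∷ X) (y ∷ Y) = begin
  bit x + bit y + size (zip X Y)  ≡⟨ cong (bit x + bit y +_) (size-zip X Y) ⟩
  bit x + bit y + (∣ X ∣ + ∣ Y ∣) ≡⟨ interchange (bit x) (bit y) _ _ ⟩
  bit x + ∣ X ∣ + (bit y + ∣ Y ∣) ≡⟨ sym (cong₂ _+_ (∣∷∣ x X) (∣∷∣ y Y)) ⟩
  ∣ x ∷ X ∣ + ∣ y ∷ Y ∣           ∎
  where
  open ≡-Reasoning
  interchange : ∀ a b c d → a + b + (c + d) ≡ a + c + (b + d)
  interchange = solve-∀

∣∣≡size : ∀ n (D : Subset (n + n)) → ∣ D ∣ ≡ size (word n D)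
∣∣≡size n D = trans (cong ∣_∣ (sym (take++drop≡id n D)))
  (trans (∣++∣ (take n D) (drop n D)) (sym (size-zip (take n D) (drop n D))))

≡ᵇ-true : ∀ m n → m ≡ n → (m ≡ᵇ n) ≡ true
≡ᵇ-true zero    .zero    refl = refl
≡ᵇ-true (suc m) .(suc m) refl = ≡ᵇ-true m m refl

≡ᵇ-true⁻¹ : ∀ m n → (m ≡ᵇ n) ≡ true → m ≡ n
≡ᵇ-true⁻¹ m n eq = ≡ᵇ⇒≡ m n (subst T (sym eq) _)

bit-* : ∀ p q → bit p * bit q ≢ 0 → p ≡ true × q ≡ true
bit-* true  true  _  = refl , refl
bit-* true  false ≢0 = contradiction refl ≢0
bit-* false q     ≢0 = contradiction refl ≢0

-- Turns a characterisation by two Boolean tests into an equality of indicators, so that two counts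
-- can be compared summand by summand.
bit-does : ∀ {P : Set} (P? : Dec P) {p q} → (P → p ≡ true × q ≡ true) → (p ≡ true → q ≡ true → P) →
  bit (does P?) ≡ bit p * bit q
bit-does (yes x) f g with refl , refl ← f x = refl
bit-does (no ¬x) {true}  {true}  f g = contradiction (g refl refl) ¬x
bit-does (no ¬x) {true}  {false} f g = refl
bit-does (no ¬x) {false} {q}     f g = refl

cost-swap : ∀ a b c → cost (swap a) (swap b) (swap c) ≡ cost a b c
cost-swap a b c = +-comm (surplus (row₂ a b c)) _

-- A record rather than a function type: conversion checking must not unfold DV.
record HasDV (n x : ℕ) : Set where
  constructor hasDV
  field
    DV≡ : ∀ v → DV (P₂□C n) v ≡ x

-- Minimum dominating sets as sets of least excess

module _ (m : ℕ) where

  private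
    n = suc m

  excess : Subset (n + n) → ℕ
  excess D = cyclic cost (word n D)

  dominating⇒covered : ∀ {D} → IsDominating (P₂□C n) D → ∀ s → Covered (word n D) s
  dominating⇒covered {D} dom s with dom (join n n s)
  ... | inj₁ v∈D =
    inj₁ (trans (cong (value (word n D)) (sym (splitAt-join n n s)))
                (trans (sym (lookup≡value n D _)) ([]=⇒lookup v∈D)))
  ... | inj₂ (u , u∈D , adj) =
    inj₂ (splitAt n u , trans (sym (lookup≡value n D u)) ([]=⇒lookup u∈D)
         , subst (PrismAdj′ n (splitAt n u)) (splitAt-join n n s) adj)

  covered⇒dominating : ∀ {D} → (∀ s → Covered (word n D) s) → IsDominating (P₂□C n) D
  covered⇒dominating {D} cov v with cov (splitAt n v)
  ... | inj₁ eq = inj₁ (lookup⇒[]= v D (trans (lookup≡value n D v) eq))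
  ... | inj₂ (t , eq , adj) =
    inj₂ (join n n t
         , lookup⇒[]= _ D (trans (lookup≡value n D _) (trans (cong (value (word n D)) (splitAt-join n n t)) eq))
         , subst (λ t → PrismAdj′ n t (splitAt n v)) (sym (splitAt-join n n t)) adj)

  excess≤4⇒dominating : ∀ D → excess D ≤ 4 → IsDominating (P₂□C n) D
  excess≤4⇒dominating D le =
    covered⇒dominating λ s → dominated⇒covered (word n D) s (cyclic-cost≤4⇒dominated (word n D) le s)

  -- Consequently cardinality and excess order the dominating sets in the same way.
  4*∣∣≡2*n+excess : ∀ {D} → IsDominating (P₂□C n) D → 4 * ∣ D ∣ ≡ 2 * n + excess D
  4*∣∣≡2*n+excess {D} dom = trans (cong (4 *_) (∣∣≡size n D))
    (4*size≡2*n+cyclic-cost (word n D) λ s → covered⇒dominated (word n D) s (dominating⇒covered dom s))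

  hit : ℕ → Fin (n + n) → Subset (n + n) → ℕ
  hit e v D = bit (excess D ≡ᵇ e) * bit (lookup D v)

  tally : ℕ → Fin (n + n) → ℕ
  tally e v = sumVec bools (n + n) (hit e v)

  tally≡0 : ∀ {e} v → tally e v ≡ 0 → ∀ D → excess D ≡ e → lookup D v ≢ true
  tally≡0 {e} v eq D ex v∈D
    with () ← trans (sym (cong₂ (λ p q → bit p * bit q) (≡ᵇ-true (excess D) e ex) v∈D))
                    (sumVec-≡0 ∈-bools (n + n) {hit e v} eq D)

  tally≢0 : ∀ {e} v → tally e v ≢ 0 → ∃ λ D → excess D ≡ e
  tally≢0 {e} v ≢0 with D , ≢0′ ← sumVec-≢0 bools (n + n) {hit e v} ≢0 =
    D , ≡ᵇ-true⁻¹ (excess D) e (proj₁ (bit-* (excess D ≡ᵇ e) (lookup D v) ≢0′))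

  -- `some` yields a subset of excess `e`, dominating because `e ≤ 4`, and `none` excludes smaller
  -- excess for every nonempty subset. So the minimum dominating sets are exactly the subsets of
  -- excess `e` that have an element.
  DV≡tally : ∀ {e} → e ≤ 4 → (∀ e′ → e′ < e → ∀ v → tally e′ v ≡ 0) →
    ∀ v → tally e v ≢ 0 → DV (P₂□C n) v ≡ tally e v
  DV≡tally {e} e≤4 none v some = trans (count≡sumVec minimum?)
    (sumVec-cong bools (n + n) λ D → bit-does (minimum? D) (minimum⇒ D) (minimum⇐ D))
    where
    minimum? : Decidable λ D → IsMinDominating (P₂□C n) D × v ∈ D
    minimum? D = isMinDominating? (P₂□C n) D ×-dec (v ∈? D)

    e≤excess : ∀ D v → lookup D v ≡ true → e ≤ excess D
    e≤excess D v v∈D = ≮⇒≥ λ lt → tally≡0 v (none (excess D) lt v) D refl v∈D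

    -- A tally sees only subsets containing a given vertex, so the lower bound on the excess needs
    -- an element of the set. One exists because vertex `zero` is dominated.
    nonempty : ∀ {D} → IsDominating (P₂□C n) D → ∃ λ v → lookup D v ≡ true
    nonempty dom with dom zero
    ... | inj₁ 0∈D           = zero , []=⇒lookup 0∈D
    ... | inj₂ (u , u∈D , _) = u , []=⇒lookup u∈D

    minimum⇒ : ∀ D → IsMinDominating (P₂□C n) D × v ∈ D → (excess D ≡ᵇ e) ≡ true × lookup D v ≡ true
    minimum⇒ D ((dom , min) , v∈D) with D₀ , ex ← tally≢0 v some =
      ≡ᵇ-true (excess D) e (≤-antisym excess≤e (e≤excess D v ([]=⇒lookup v∈D))) , []=⇒lookup v∈D
      where
      dom₀ = excess≤4⇒dominating D₀ (subst (_≤ 4) (sym ex) e≤4)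
      -- Minimality of `D` against `D₀`, multiplied by 4, with the common term `2 * n` cancelled.
      excess≤e : excess D ≤ e
      excess≤e = +-cancelˡ-≤ (2 * n) _ _
        (subst₂ _≤_ (4*∣∣≡2*n+excess dom) (trans (4*∣∣≡2*n+excess dom₀) (cong (2 * n +_) ex))
          (*-monoʳ-≤ 4 (min D₀ dom₀)))

    minimum⇐ : ∀ D → (excess D ≡ᵇ e) ≡ true → lookup D v ≡ true → IsMinDominating (P₂□C n) D × v ∈ D
    minimum⇐ D eq v∈D = (dom , min) , lookup⇒[]= v D v∈D
      where
      ex  = ≡ᵇ-true⁻¹ (excess D) e eq
      dom = excess≤4⇒dominating D (subst (_≤ 4) (sym ex) e≤4)
      min : ∀ D′ → IsDominating (P₂□C n) D′ → ∣ D ∣ ≤ ∣ D′ ∣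
      min D′ dom′ with u , u∈D′ ← nonempty dom′ = *-cancelˡ-≤ 4
        (subst₂ _≤_ (sym (trans (4*∣∣≡2*n+excess dom) (cong (2 * n +_) ex))) (sym (4*∣∣≡2*n+excess dom′))
          (+-monoʳ-≤ (2 * n) (e≤excess D′ u u∈D′)))

  -- Independence of the vertex

  wordHit : ℕ → Fin n ⊎ Fin n → Vec Column n → ℕ
  wordHit e s w = bit (cyclic cost w ≡ᵇ e) * bit (value w s)

  wordTally : ℕ → Fin n ⊎ Fin n → ℕ
  wordTally e s = sumVec columns n (wordHit e s)

  tally≡wordTally : ∀ e v → tally e v ≡ wordTally e (splitAt n v)
  tally≡wordTally e v = begin
    tally e v
      ≡⟨ sumVec-++ bools n n (hit e v) ⟩
    (sumVec bools n λ X → sumVec bools n λ Y → hit e v (X ++ Y))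
      ≡⟨ (sumVec-cong bools n λ X → sumVec-cong bools n λ Y →
            trans (cong (λ b → bit (excess (X ++ Y) ≡ᵇ e) * bit b) (lookup≡value n (X ++ Y) v))
                  (cong (wordHit e (splitAt n v)) (word-++ X Y))) ⟩
    (sumVec bools n λ X → sumVec bools n λ Y → wordHit e (splitAt n v) (zip X Y))
      ≡⟨ sumVec-zip n (wordHit e (splitAt n v)) ⟩
    wordTally e (splitAt n v) ∎
    where open ≡-Reasoning

  -- Rotation keeps the cyclic cost and moves the letter at `suc i` to `inject₁ i`; the sum over all
  -- words is invariant under it.
  wordTally-rotate : ∀ e i → wordTally e (inj₁ (inject₁ i)) ≡ wordTally e (inj₁ (suc i))
  wordTally-rotate e i = trans (sym (sumVec-rotate columns n (wordHit e (inj₁ (inject₁ i)))))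
    (sumVec-cong columns n rotated)
    where
    rotated : ∀ w → wordHit e (inj₁ (inject₁ i)) (rotate w) ≡ wordHit e (inj₁ (suc i)) w
    rotated w@(c ∷ u) = cong₂ (λ k b → bit (k ≡ᵇ e) * bit (proj₁ b)) (cyclic-rotate cost w) (lookup-∷ʳ u c i)

  wordTally-swap : ∀ e i → wordTally e (inj₂ i) ≡ wordTally e (inj₁ i)
  wordTally-swap e i = sym (trans (sym (sumVec-map columns swap sumOver-swapped n (wordHit e (inj₁ i))))
    (sumVec-cong columns n λ w →
      cong₂ (λ k b → bit (k ≡ᵇ e) * bit (proj₁ b)) (cyclic-map cost swap cost-swap w) (lookup-map i swap w)))

  -- Rotations connect consecutive positions of the first row, and exchanging the rows reaches the
  -- second.
  wordTally≡ : ∀ e s → wordTally e s ≡ wordTally e (inj₁ zero)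
  wordTally≡ e (inj₁ i) =
    <-weakInduction (λ i → wordTally e (inj₁ i) ≡ wordTally e (inj₁ zero)) refl
      (λ i → trans (sym (wordTally-rotate e i))) i
  wordTally≡ e (inj₂ i) = trans (wordTally-swap e i) (wordTally≡ e (inj₁ i))

  wordTally⇒HasDV : ∀ {e} → e ≤ 4 → (∀ e′ → e′ < e → wordTally e′ (inj₁ zero) ≡ 0) →
    wordTally e (inj₁ zero) ≢ 0 → HasDV n (wordTally e (inj₁ zero))
  wordTally⇒HasDV {e} e≤4 none some = hasDV λ v → trans
    (DV≡tally e≤4 (λ e′ lt v → trans (at-x₀ e′ v) (none e′ lt)) v (λ z → some (trans (sym (at-x₀ e v)) z)))
    (at-x₀ e v)
    where
    at-x₀ : ∀ e v → tally e v ≡ wordTally e (inj₁ zero)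
    at-x₀ e v = trans (tally≡wordTally e v) (wordTally≡ e (splitAt n v))

-- The transfer operator: walks c d m a b e counts the words w of length m such that the walk
-- a, b, w, c, d has total cost e.

-- On generating functions in the cost, `delay k` is multiplication by the `k`-th power of the
-- variable.
delay : ℕ → (ℕ → ℕ) → ℕ → ℕ
delay zero    f e       = f e
delay (suc k) f zero    = 0
delay (suc k) f (suc e) = delay k f e

Weight : Set
Weight = Column → Column → ℕ → ℕ

-- One application of the transfer operator: column `a` is put in front of a walk starting with `b`,
-- `c`, and the new window pays `cost a b c`.
extend : Weight → Weight
extend f a b e = sumOver columns λ c → delay (cost a b c) (f b c) e

-- The summand 0 is the cost of the empty walk; with it the value agrees with `walk` by computation.
seed : Column → Column → Weight
seed c d a b e = bit (cost a b c + (cost b c d + 0) ≡ᵇ e)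

walks : Column → Column → ℕ → Weight
walks c d zero    = seed c d
walks c d (suc m) = extend (walks c d m)

sumVec-delay : ∀ {A : Set} (xs : List A) n k (g : Vec A n → ℕ) e →
  sumVec xs n (λ w → bit (k + g w ≡ᵇ e)) ≡ delay k (λ e → sumVec xs n λ w → bit (g w ≡ᵇ e)) e
sumVec-delay xs n zero    g e       = refl
sumVec-delay xs n (suc k) g zero    = sumVec-* xs n 0 λ _ → 0
sumVec-delay xs n (suc k) g (suc e) = sumVec-delay xs n k g e

delay-cong : ∀ k {f g} e → (∀ e′ → e′ ≤ e → f e′ ≡ g e′) → delay k f e ≡ delay k g e
delay-cong zero    e       eq = eq e ≤-refl
delay-cong (suc k) zero    eq = refl
delay-cong (suc k) (suc e) eq = delay-cong k e λ e′ le → eq e′ (m≤n⇒m≤1+n le)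

sumVec-walks : ∀ c d m a b e →
  sumVec columns m (λ w → bit (walk cost a (b ∷ (w ∷ʳ c)) d ≡ᵇ e)) ≡ walks c d m a b e
sumVec-walks c d zero    a b e = refl
sumVec-walks c d (suc m) a b e = sumOver-cong columns λ x →
  trans (sumVec-delay columns m (cost a b x) (λ w → walk cost b (x ∷ (w ∷ʳ c)) d) e)
        (delay-cong (cost a b x) e λ e′ _ → sumVec-walks c d m b x e′)

-- A closed walk begins and ends with the same columns `c`, `d`; the factor `bit (proj₁ c)` keeps
-- those whose first column contains x₀.
closed : (Column → Column → Weight) → ℕ → ℕ
closed f e = sumOver columns λ c → sumOver columns λ d → bit (proj₁ c) * f c d c d e

-- The first two letters serve as both ends of the walk, so a word of length `2 + m` leaves `m` free
-- letters.
wordTally≡closed : ∀ m e → wordTally (suc m) e (inj₁ zero) ≡ closed (λ c d → walks c d m) e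
wordTally≡closed m e = sumOver-cong columns λ c → sumOver-cong columns λ d →
  trans (sumVec-cong columns m λ w →
          trans (*-comm (bit (cyclic cost (c ∷ d ∷ w) ≡ᵇ e)) (bit (proj₁ c)))
                (cong (λ k → bit (proj₁ c) * bit (k ≡ᵇ e)) (unroll c d w)))
    (trans (sumVec-* columns m (bit (proj₁ c)) _)
           (cong (bit (proj₁ c) *_) (sumVec-walks c d m c d e)))
  where
  -- After one rotation the word reads `d`, `w`, `c`, and its boundary letters are `c` and `d`.
  unroll : ∀ c d (w : Vec Column m) → cyclic cost (c ∷ d ∷ w) ≡ walk cost c (d ∷ (w ∷ʳ c)) d
  unroll c d w = trans (sym (cyclic-rotate cost (c ∷ d ∷ w)))
    (cong (λ a → walk cost a (d ∷ (w ∷ʳ c)) d) (lastOr-∷ʳ d w c))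

-- Tables of the values of a weight at costs at most 4

infix 4 _≈_
_≈_ : Weight → Weight → Set
f ≈ g = ∀ a b e → e ≤ 4 → f a b e ≡ g a b e

-- After extension, the count at cost `e` uses only counts at costs at most `e`, so cutting off at
-- cost 4 is compatible with the transfer operator.
extend-cong : ∀ {f g} → f ≈ g → extend f ≈ extend g
extend-cong eq a b e le = sumOver-cong columns λ c →
  delay-cong (cost a b c) e λ e′ le′ → eq b c e′ (≤-trans le′ le)

Square : Set → Set
Square A = (A × A) × (A × A)

module _ {A : Set} where

  square : (Column → A) → Square A
  square f = (f (true , true) , f (true , false)) , (f (false , true) , f (false , false))

  at : Square A → Column → A
  at ((p , q) , (r , s)) (true  , true)  = p
  at ((p , q) , (r , s)) (true  , false) = q
  at ((p , q) , (r , s)) (false , true)  = r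
  at ((p , q) , (r , s)) (false , false) = s

  at-square : ∀ f c → at (square f) c ≡ f c
  at-square f (true  , true)  = refl
  at-square f (true  , false) = refl
  at-square f (false , true)  = refl
  at-square f (false , false) = refl

entries : ∀ n → (ℕ → ℕ) → Vec ℕ n
entries zero    f = []
entries (suc n) f = f zero ∷ entries n (f ∘ suc)

entry : ∀ {n} → Vec ℕ n → ℕ → ℕ
entry []      e       = 0
entry (x ∷ v) zero    = x
entry (x ∷ v) (suc e) = entry v e

entry-entries : ∀ n f e → e < n → entry (entries n f) e ≡ f e
entry-entries (suc n) f zero    _        = refl
entry-entries (suc n) f (suc e) (s≤s lt) = entry-entries n (f ∘ suc) e lt

-- The five entries belong to the costs 0 to 4. As the values are held as data, each step is
-- computed from the stored values of the previous one.
Table : Set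
Table = Square (Square (Vec ℕ 5))

table : Weight → Table
table f = square λ a → square λ b → entries 5 (f a b)

fetch : Table → Weight
fetch t a b = entry (at (at t a) b)

fetch-table : ∀ f → fetch (table f) ≈ f
fetch-table f a b e le = trans
  (cong (λ v → entry v e) (trans (cong (λ u → at u b) (at-square (λ a → square λ b → entries 5 (f a b)) a))
                                 (at-square (λ b → entries 5 (f a b)) b)))
  (entry-entries 5 (f a b) e (s≤s le))

steps : ℕ → Table → Table
steps zero    t = t
steps (suc k) t = table (extend (fetch (steps k t)))

steps-walks : ∀ {c d m t} k → fetch t ≈ walks c d m → fetch (steps k t) ≈ walks c d (k + m)
steps-walks zero    eq = eq
steps-walks {t = t} (suc k) eq a b e le =
  trans (fetch-table (extend (fetch (steps k t))) a b e le) (extend-cong (steps-walks {t = t} k eq) a b e le)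

-- Quadratic growth of the numbers of walks

linear : Weight → Weight → Weight → ℕ → ℕ → Weight
linear f g h k l a b e = f a b e + (k * g a b e + l * h a b e)

sumOver-linear : ∀ {A : Set} (xs : List A) f g h k l →
  sumOver xs (λ a → f a + (k * g a + l * h a)) ≡ sumOver xs f + (k * sumOver xs g + l * sumOver xs h)
sumOver-linear xs f g h k l = trans (sumOver-+ xs f _)
  (cong (sumOver xs f +_) (trans (sumOver-+ xs (λ a → k * g a) _)
    (cong₂ _+_ (sumOver-* xs k g) (sumOver-* xs l h))))

delay-linear : ∀ p (f g h : ℕ → ℕ) k l e →
  delay p (λ e → f e + (k * g e + l * h e)) e ≡ delay p f e + (k * delay p g e + l * delay p h e)
delay-linear zero    f g h k l e       = refl
delay-linear (suc p) f g h k l zero    = sym (cong₂ _+_ (*-zeroʳ k) (*-zeroʳ l))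
delay-linear (suc p) f g h k l (suc e) = delay-linear p f g h k l e

extend-linear : ∀ f g h k l → extend (linear f g h k l) ≈ linear (extend f) (extend g) (extend h) k l
extend-linear f g h k l a b e _ = trans
  (sumOver-cong columns λ c → delay-linear (cost a b c) (f b c) (g b c) (h b c) k l e)
  (sumOver-linear columns (λ c → delay (cost a b c) (f b c) e) (λ c → delay (cost a b c) (g b c) e)
    (λ c → delay (cost a b c) (h b c) e) k l)

-- The transfer operator is linear, so a combination of tables may be advanced table by table.
steps-linear : ∀ {c d m t₀ t₁ t₂ k l} j → walks c d m ≈ linear (fetch t₀) (fetch t₁) (fetch t₂) k l →
  walks c d (j + m) ≈ linear (fetch (steps j t₀)) (fetch (steps j t₁)) (fetch (steps j t₂)) k l
steps-linear zero eq = eq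
steps-linear {t₀ = t₀} {t₁} {t₂} {k} {l} (suc j) eq a b e le = begin
  extend (walks _ _ (j + _)) a b e                   ≡⟨ extend-cong (steps-linear {t₀ = t₀} {t₁} {t₂} {k} {l} j eq) a b e le ⟩
  extend (linear (f t₀) (f t₁) (f t₂) k l) a b e     ≡⟨ extend-linear (f t₀) (f t₁) (f t₂) k l a b e le ⟩
  linear (extend (f t₀)) (extend (f t₁)) (extend (f t₂)) k l a b e
    ≡⟨ sym (cong₂ _+_ (refetch t₀) (cong₂ _+_ (cong (k *_) (refetch t₁)) (cong (l *_) (refetch t₂)))) ⟩
  linear (fetch (steps (suc j) t₀)) (fetch (steps (suc j) t₁)) (fetch (steps (suc j) t₂)) k l a b e ∎
  where
  open ≡-Reasoning
  f : Table → Weight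
  f t = fetch (steps j t)
  refetch : ∀ t → fetch (steps (suc j) t) a b e ≡ extend (f t) a b e
  refetch t = fetch-table (extend (f t)) a b e le

everywhere : (Column → Bool) → Bool
everywhere p = (p (true , true) ∧ p (true , false)) ∧ (p (false , true) ∧ p (false , false))

∧-true : ∀ p q → p ∧ q ≡ true → p ≡ true × q ≡ true
∧-true true q eq = refl , eq

everywhere-sound : ∀ p → everywhere p ≡ true → ∀ c → p c ≡ true
everywhere-sound p eq c with ∧-true (p (true , true) ∧ p (true , false)) _ eq
... | eq₁ , eq₂ with ∧-true (p (true , true)) _ eq₁ | ∧-true (p (false , true)) _ eq₂
everywhere-sound p eq (true  , true)  | _ | r , _ | _ = r
everywhere-sound p eq (true  , false) | _ | _ , r | _ = r
everywhere-sound p eq (false , true)  | _ | _ | r , _ = r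
everywhere-sound p eq (false , false) | _ | _ | _ , r = r

upTo? : ℕ → (ℕ → Bool) → Bool
upTo? zero    p = p zero
upTo? (suc n) p = p (suc n) ∧ upTo? n p

upTo?-sound : ∀ n p → upTo? n p ≡ true → ∀ e → e ≤ n → p e ≡ true
upTo?-sound zero    p eq zero z≤n = eq
upTo?-sound (suc n) p eq e le with ∧-true (p (suc n)) _ eq | m≤n⇒m<n∨m≡n le
... | _ , r | inj₁ (s≤s le′) = upTo?-sound n p r e le′
... | r , _ | inj₂ refl      = r

isSum : Table → Table → Table → Bool
isSum t u v = everywhere λ a → everywhere λ b → upTo? 4 λ e → fetch t a b e ≡ᵇ fetch u a b e + fetch v a b e

isSum-sound : ∀ t u v → isSum t u v ≡ true → ∀ a b e → e ≤ 4 → fetch t a b e ≡ fetch u a b e + fetch v a b e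
isSum-sound t u v eq a b e le = ≡ᵇ-true⁻¹ (fetch t a b e) _
  (upTo?-sound 4 (agree a b) (everywhere-sound (λ b → upTo? 4 (agree a b))
    (everywhere-sound (λ a → everywhere λ b → upTo? 4 (agree a b)) eq a) b) e le)
  where
  agree : Column → Column → ℕ → Bool
  agree a b e = fetch t a b e ≡ᵇ fetch u a b e + fetch v a b e

difference : Table → Table → Table
difference t u = table λ a b e → fetch t a b e ∸ fetch u a b e

-- With S the operator of `j` steps, the conditions are S t₀ = t₀ + t₁, S t₁ = t₁ + t₂ and S t₂ = t₂
-- at costs at most 4, so the third difference of `t₀` under S vanishes. They are stated with sums
-- because subtraction of natural numbers truncates.
grows : ℕ → Table → Table → Table → Bool
grows j t₀ t₁ t₂ = isSum (steps j t₀) t₀ t₁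
  ∧ (isSum (steps j t₁) t₁ t₂ ∧ isSum (steps j t₂) t₂ (table λ _ _ _ → 0))

-- The binomial coefficient of `k` over 2, which multiplies the second difference in Newton's
-- formula.
triangle : ℕ → ℕ
triangle zero    = 0
triangle (suc k) = triangle k + k

-- The coefficients `k` and `l` become `suc k` and `l + k`: Pascal's rule.
linear-grow : ∀ j t₀ t₁ t₂ → grows j t₀ t₁ t₂ ≡ true → ∀ k l →
  linear (fetch (steps j t₀)) (fetch (steps j t₁)) (fetch (steps j t₂)) k l
  ≈ linear (fetch t₀) (fetch t₁) (fetch t₂) (suc k) (l + k)
linear-grow j t₀ t₁ t₂ eq k l a b e le
  with eq₀ , eq₁₂ ← ∧-true (isSum (steps j t₀) t₀ t₁) _ eq
  with eq₁ , eq₂ ← ∧-true (isSum (steps j t₁) t₁ t₂) _ eq₁₂ = begin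
  fetch (steps j t₀) a b e + (k * fetch (steps j t₁) a b e + l * fetch (steps j t₂) a b e)
    ≡⟨ cong₂ _+_ (isSum-sound (steps j t₀) t₀ t₁ eq₀ a b e le)
         (cong₂ (λ p q → k * p + l * q) (isSum-sound (steps j t₁) t₁ t₂ eq₁ a b e le)
           (trans (isSum-sound (steps j t₂) t₂ (table λ _ _ _ → 0) eq₂ a b e le)
                  (cong (v₂ +_) (fetch-table (λ _ _ _ → 0) a b e le)))) ⟩
  v₀ + v₁ + (k * (v₁ + v₂) + l * (v₂ + 0))
    ≡⟨ regroup v₀ v₁ v₂ k l ⟩
  v₀ + (suc k * v₁ + (l + k) * v₂) ∎
  where
  open ≡-Reasoning
  v₀ = fetch t₀ a b e
  v₁ = fetch t₁ a b e
  v₂ = fetch t₂ a b e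
  regroup : ∀ v₀ v₁ v₂ k l → v₀ + v₁ + (k * (v₁ + v₂) + l * (v₂ + 0)) ≡ v₀ + (suc k * v₁ + (l + k) * v₂)
  regroup = solve-∀

-- Newton's forward difference formula for `k` blocks of `j` steps, by induction on `k`.
walks-grow : ∀ {c d} m j t₀ t₁ t₂ → fetch t₀ ≈ walks c d m → grows j t₀ t₁ t₂ ≡ true → ∀ k →
  walks c d (k * j + m) ≈ linear (fetch t₀) (fetch t₁) (fetch t₂) k (triangle k)
walks-grow m j t₀ t₁ t₂ start eq zero a b e le = trans (sym (start a b e le)) (sym (+-identityʳ _))
walks-grow {c} {d} m j t₀ t₁ t₂ start eq (suc k) a b e le = begin
  walks c d (j + k * j + m) a b e
    ≡⟨ cong (λ i → walks c d i a b e) (+-assoc j (k * j) m) ⟩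
  walks c d (j + (k * j + m)) a b e
    ≡⟨ steps-linear {t₀ = t₀} {t₁} {t₂} {k} {triangle k} j (walks-grow m j t₀ t₁ t₂ start eq k) a b e le ⟩
  linear (fetch (steps j t₀)) (fetch (steps j t₁)) (fetch (steps j t₂)) k (triangle k) a b e
    ≡⟨ linear-grow j t₀ t₁ t₂ eq k (triangle k) a b e le ⟩
  linear (fetch t₀) (fetch t₁) (fetch t₂) (suc k) (triangle k + k) a b e ∎
  where open ≡-Reasoning

-- The differences b₁ and b₂ use truncated subtraction; after five initial steps nothing is truncated,
-- which b-grows confirms for the letters c containing x₀.
b₀ b₁ b₂ : Column → Column → Table
b₀ c d = steps 5 (table (seed c d))
b₁ c d = difference (steps 4 (b₀ c d)) (b₀ c d)
b₂ c d = difference (steps 4 (b₁ c d)) (b₁ c d)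

b-grows : ∀ y d → grows 4 (b₀ (true , y) d) (b₁ (true , y) d) (b₂ (true , y) d) ≡ true
b-grows true  = everywhere-sound (λ d → grows 4 (b₀ (true , true) d) (b₁ (true , true) d) (b₂ (true , true) d)) refl
b-grows false = everywhere-sound (λ d → grows 4 (b₀ (true , false) d) (b₁ (true , false) d) (b₂ (true , false) d)) refl

b₀-walks : ∀ c d → fetch (b₀ c d) ≈ walks c d 5
b₀-walks c d = steps-walks {c} {d} {0} {table (seed c d)} 5 (fetch-table (seed c d))

walks-quadratic : ∀ y d k → let c = (true , y) in
  walks c d (k * 4 + 5) ≈ linear (fetch (b₀ c d)) (fetch (b₁ c d)) (fetch (b₂ c d)) k (triangle k)
walks-quadratic y d =
  walks-grow {true , y} {d} 5 4 (b₀ (true , y) d) (b₁ (true , y) d) (b₂ (true , y) d) (b₀-walks (true , y) d) (b-grows y d)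

-- Counting closed walks by quadratic polynomials

closed-cong : ∀ (f g : Column → Column → Weight) → (∀ y d → f (true , y) d ≈ g (true , y) d) →
  ∀ e → e ≤ 4 → closed f e ≡ closed g e
closed-cong f g eq e le = sumOver-cong columns λ c → sumOver-cong columns λ d → summand c d
  where
  summand : ∀ c d → bit (proj₁ c) * f c d c d e ≡ bit (proj₁ c) * g c d c d e
  summand (true  , y) d = cong (1 *_) (eq y d (true , y) d e le)
  -- Both sides vanish when `c` does not contain x₀, so agreement for the letters containing x₀
  -- suffices.
  summand (false , y) d = refl

closed-linear : ∀ (f g h : Column → Column → Weight) k l e →
  closed (λ c d → linear (f c d) (g c d) (h c d) k l) e ≡ closed f e + (k * closed g e + l * closed h e)
closed-linear f g h k l e = trans
  (sumOver-cong columns λ c → trans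
    (sumOver-cong columns λ d → distribute (bit (proj₁ c)) (f c d c d e) (g c d c d e) (h c d c d e) k l)
    (sumOver-linear columns (λ d → bit (proj₁ c) * f c d c d e) (λ d → bit (proj₁ c) * g c d c d e)
      (λ d → bit (proj₁ c) * h c d c d e) k l))
  (sumOver-linear columns (λ c → sumOver columns λ d → bit (proj₁ c) * f c d c d e)
    (λ c → sumOver columns λ d → bit (proj₁ c) * g c d c d e)
    (λ c → sumOver columns λ d → bit (proj₁ c) * h c d c d e) k l)
  where
  distribute : ∀ b x y z k l → b * (x + (k * y + l * z)) ≡ b * x + (k * (b * y) + l * (b * z))
  distribute = solve-∀

closedWalks : ℕ → ℕ → ℕ
closedWalks m = closed λ c d → walks c d m

closedSteps : ℕ → (Column → Column → Table) → ℕ → ℕ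
closedSteps r t = closed λ c d → fetch (steps r (t c d))

seeds : Column → Column → Table
seeds c d = table (seed c d)

closedWalks-table : ∀ m e → e ≤ 4 → closedWalks m e ≡ closedSteps m seeds e
closedWalks-table m e le = trans (cong (λ m → closedWalks m e) (sym (+-identityʳ m)))
  (sym (closed-cong (λ c d → fetch (steps m (seeds c d))) (λ c d → walks c d (m + 0))
    (λ y d → steps-walks {true , y} {d} {0} {seeds (true , y) d} m (fetch-table (seed (true , y) d))) e le))

Coefficients : Set
Coefficients = ℕ × ℕ × ℕ

-- Newton form: `x` is the value at 0, and `y` and `z` are the first and second differences there.
quadratic : Coefficients → ℕ → ℕ
quadratic (x , y , z) k = x + (k * y + triangle k * z)

coefficients : ℕ → ℕ → Coefficients
coefficients r e = closedSteps r b₀ e , closedSteps r b₁ e , closedSteps r b₂ e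

-- Five initial steps and `k` blocks of four are followed by `r` steps, which select the residue
-- class of the length modulo 4.
closedWalks-quadratic : ∀ r k e → e ≤ 4 → closedWalks (r + (k * 4 + 5)) e ≡ quadratic (coefficients r e) k
closedWalks-quadratic r k e le = trans
  (closed-cong (λ c d → walks c d (r + (k * 4 + 5)))
    (λ c d → linear (fetch (steps r (b₀ c d))) (fetch (steps r (b₁ c d))) (fetch (steps r (b₂ c d))) k (triangle k))
    (λ y d → steps-linear {true , y} {d} {k * 4 + 5} {b₀ (true , y) d} {b₁ (true , y) d} {b₂ (true , y) d}
      {k} {triangle k} r (walks-quadratic y d k)) e le)
  (closed-linear (λ c d → fetch (steps r (b₀ c d))) (λ c d → fetch (steps r (b₁ c d)))
    (λ c d → fetch (steps r (b₂ c d))) k (triangle k) e)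

quadratic-zero : ∀ k → quadratic (0 , 0 , 0) k ≡ 0
quadratic-zero k = cong₂ _+_ (*-zeroʳ k) (*-zeroʳ (triangle k))

closedWalks⇒HasDV : ∀ m {e} → e ≤ 4 → (∀ e′ → e′ < e → closedWalks m e′ ≡ 0) → closedWalks m e ≢ 0 →
  HasDV (suc (suc m)) (closedWalks m e)
closedWalks⇒HasDV m {e} le none some = subst (HasDV (suc (suc m))) (wordTally≡closed m e)
  (wordTally⇒HasDV (suc m) le (λ e′ lt → trans (wordTally≡closed m e′) (none e′ lt))
    (λ z → some (trans (sym (wordTally≡closed m e)) z)))

closedSteps⇒HasDV : ∀ m {e x} → e ≤ 4 →
  (∀ e′ → e′ < e → closedSteps m seeds e′ ≡ 0) → closedSteps m seeds e ≡ suc x →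
  HasDV (suc (suc m)) (suc x)
closedSteps⇒HasDV m {e} {x} le none some = subst (HasDV (suc (suc m))) eq
  (closedWalks⇒HasDV m le (λ e′ lt → trans (closedWalks-table m e′ (≤-trans (<⇒≤ lt) le)) (none e′ lt))
    λ z → contradiction (trans (sym z) eq) λ ())
  where
  eq : closedWalks m e ≡ suc x
  eq = trans (closedWalks-table m e le) some

-- Below cost `e` the polynomials are zero, while the constant term `suc x` keeps the count at cost
-- `e` nonzero for every `k`.
coefficients⇒HasDV : ∀ r {e x y z} → e ≤ 4 → (∀ e′ → e′ < e → coefficients r e′ ≡ (0 , 0 , 0)) →
  coefficients r e ≡ (suc x , y , z) →
  ∀ k → HasDV (suc (suc (r + (k * 4 + 5)))) (quadratic (suc x , y , z) k)
coefficients⇒HasDV r {e} {x} {y} {z} le none some k = subst (HasDV (suc (suc (r + (k * 4 + 5))))) eq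
  (closedWalks⇒HasDV (r + (k * 4 + 5)) le
    (λ e′ lt → trans (closedWalks-quadratic r k e′ (≤-trans (<⇒≤ lt) le))
      (trans (cong (λ p → quadratic p k) (none e′ lt)) (quadratic-zero k)))
    λ z → contradiction (trans (sym z) eq) λ ())
  where
  eq : closedWalks (r + (k * 4 + 5)) e ≡ quadratic (suc x , y , z) k
  eq = trans (closedWalks-quadratic r k e le) (cong (λ p → quadratic p k) some)

-- Evaluated domination values

HasDV-3 : HasDV 3 3
-- The cost is 2 because `2 * n` is 6 and adding the cost must give a multiple of 4. Costs 0 and 1
-- are excluded by evaluation.
HasDV-3 = closedSteps⇒HasDV 1 {2} (s≤s (s≤s z≤n))
  (λ { 0 _ → refl ; 1 _ → refl ; (suc (suc _)) (s≤s (s≤s ())) }) refl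

HasDV-4 : HasDV 4 1
HasDV-4 = closedSteps⇒HasDV 2 {0} z≤n (λ _ ()) refl

HasDV-5 : HasDV 5 3
HasDV-5 = closedSteps⇒HasDV 3 {2} (s≤s (s≤s z≤n))
  (λ { 0 _ → refl ; 1 _ → refl ; (suc (suc _)) (s≤s (s≤s ())) }) refl

-- The general formula for residue 2 would give 16 here; the evaluated count is one larger.
HasDV-6 : HasDV 6 17
HasDV-6 = closedSteps⇒HasDV 4 {4} ≤-refl
  (λ { 0 _ → refl ; 1 _ → refl ; 2 _ → refl ; 3 _ → refl
     ; (suc (suc (suc (suc _)))) (s≤s (s≤s (s≤s (s≤s ())))) }) refl

-- The first length is 7: two end columns and five initial steps. The second difference is 0, so the
-- value grows by 2 with every four columns.
HasDV-7+4k : ∀ k → HasDV (2 + (0 + (k * 4 + 5))) (quadratic (4 , 2 , 0) k)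
HasDV-7+4k = coefficients⇒HasDV 0 {2} (s≤s (s≤s z≤n))
  (λ { 0 _ → refl ; 1 _ → refl ; (suc (suc _)) (s≤s (s≤s ())) }) refl

HasDV-8+4k : ∀ k → HasDV (2 + (1 + (k * 4 + 5))) (quadratic (1 , 0 , 0) k)
HasDV-8+4k = coefficients⇒HasDV 1 {0} z≤n (λ _ ()) refl

HasDV-9+4k : ∀ k → HasDV (2 + (2 + (k * 4 + 5))) (quadratic (5 , 2 , 0) k)
HasDV-9+4k = coefficients⇒HasDV 2 {2} (s≤s (s≤s z≤n))
  (λ { 0 _ → refl ; 1 _ → refl ; (suc (suc _)) (s≤s (s≤s ())) }) refl

-- Here 4 divides `2 * n`, so the cost of a dominating set is a multiple of 4. Cost 0 does not
-- occur, so the least cost is 4, where the count is truly quadratic.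
HasDV-10+4k : ∀ k → HasDV (2 + (3 + (k * 4 + 5))) (quadratic (36 , 28 , 8) k)
HasDV-10+4k = coefficients⇒HasDV 3 {4} ≤-refl
  (λ { 0 _ → refl ; 1 _ → refl ; 2 _ → refl ; 3 _ → refl
     ; (suc (suc (suc (suc _)))) (s≤s (s≤s (s≤s (s≤s ())))) }) refl

-- Closed forms of the polynomials

quadratic-half : ∀ x k → quadratic (x , 2 , 0) k ≡ (x * 2 + k * 4) / 2
quadratic-half x k = trans (linearize x k (triangle k))
  (trans (sym (m*n/n≡m (x + k * 2) 2)) (cong (_/ 2) (double x k)))
  where
  linearize : ∀ x k t → x + (k * 2 + t * 0) ≡ x + k * 2
  linearize = solve-∀
  double : ∀ x k → (x + k * 2) * 2 ≡ x * 2 + k * 4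
  double = solve-∀

triangle-square : ∀ k → 2 * triangle k + k ≡ k * k
triangle-square zero    = refl
triangle-square (suc k) = trans (split (triangle k) k) (trans (cong (_+ (2 * k + 1)) (triangle-square k)) (expand k))
  where
  split : ∀ t k → 2 * (t + k) + suc k ≡ 2 * t + k + (2 * k + 1)
  split = solve-∀
  expand : ∀ k → k * k + (2 * k + 1) ≡ suc k * suc k
  expand = solve-∀

ceil-half : ∀ k → ⌈ 11 + k * 4 /2⌉ ≡ 6 + k * 2
ceil-half zero    = refl
ceil-half (suc k) = cong (2 +_) (ceil-half k)

quadratic-square : ∀ k → quadratic (36 , 28 , 8) k ≡ ⌈ 11 + k * 4 /2⌉ ^ 2
quadratic-square k = begin
  36 + (k * 28 + triangle k * 8)           ≡⟨ split k (triangle k) ⟩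
  -- Collecting twice `triangle k` with `k` yields the square of `k`, which completes the square of
  -- `6 + k * 2`.
  36 + 24 * k + 4 * (2 * triangle k + k)   ≡⟨ cong (λ s → 36 + 24 * k + 4 * s) (triangle-square k) ⟩
  36 + 24 * k + 4 * (k * k)                ≡⟨ square-sum k ⟩
  (6 + k * 2) * ((6 + k * 2) * 1)          ≡⟨ cong (_^ 2) (sym (ceil-half k)) ⟩
  ⌈ 11 + k * 4 /2⌉ ^ 2                     ∎
  where
  open ≡-Reasoning
  split : ∀ k t → 36 + (k * 28 + t * 8) ≡ 36 + 24 * k + 4 * (2 * t + k)
  split = solve-∀
  square-sum : ∀ k → 36 + 24 * k + 4 * (k * k) ≡ (6 + k * 2) * ((6 + k * 2) * 1)
  square-sum = solve-∀

-- Case distinction modulo 4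

data Case (n : ℕ) : Set where
  n≡3   : n ≡ 3 → HasDV n 3 → Case n
  n≡6   : n ≡ 6 → HasDV n 17 → Case n
  n%4≡0 : n % 4 ≡ 0 → HasDV n 1 → Case n
  -- The residue 3 alone does not separate this case from three columns, hence the component
  -- `n ≢ 3`; likewise `n ≢ 6` below.
  odd   : n % 4 ≡ 1 ⊎ n % 4 ≡ 3 → n ≢ 3 → HasDV n (suc n / 2) → Case n
  n%4≡2 : n % 4 ≡ 2 → n ≢ 6 → HasDV n (⌈ suc n /2⌉ ^ 2) → Case n

case : ∀ n → 3 ≤ n → Case n
case 3 _ = n≡3 refl HasDV-3
case 4 _ = n%4≡0 refl HasDV-4
case 5 _ = odd (inj₁ refl) (λ ()) HasDV-5
case 6 _ = n≡6 refl HasDV-6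
case (suc (suc (suc (suc (suc (suc (suc m))))))) _ =
  -- The remainder of `m` modulo 4 selects one of the four evaluated families, and the quotient is
  -- the number of four-step blocks.
  subst (λ m → Case (7 + m)) (sym (m≡m%n+[m/n]*n m 4)) (large (m % 4) (m / 4) (m%n<n m 4))
  where
  reindex : ∀ r k → 2 + (r + (k * 4 + 5)) ≡ 7 + r + k * 4
  reindex = solve-∀
  large : ∀ r k → r < 4 → Case (7 + (r + k * 4))
  large 0 k _ = odd (inj₂ ([m+kn]%n≡m%n 7 k 4)) (λ ())
    -- The numerator `4 * 2 + k * 4` computes to `suc (7 + k * 4)`, the successor of the number of
    -- columns.
    (subst₂ HasDV (reindex 0 k) (quadratic-half 4 k) (HasDV-7+4k k))
  large 1 k _ = n%4≡0 ([m+kn]%n≡m%n 8 k 4)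
    (subst₂ HasDV (reindex 1 k) (cong suc (quadratic-zero k)) (HasDV-8+4k k))
  large 2 k _ = odd (inj₁ ([m+kn]%n≡m%n 9 k 4)) (λ ())
    (subst₂ HasDV (reindex 2 k) (quadratic-half 5 k) (HasDV-9+4k k))
  large 3 k _ = n%4≡2 ([m+kn]%n≡m%n 10 k 4) (λ ())
    (subst₂ HasDV (reindex 3 k) (quadratic-square k) (HasDV-10+4k k))
  large (suc (suc (suc (suc r)))) k (s≤s (s≤s (s≤s (s≤s ()))))
case 2 (s≤s (s≤s ()))
case 1 (s≤s ())

theorem4p3 : ∀ (n : ℕ) → 3 ≤ n → ∀ (v : Fin (n + n)) →
    (n % 4 ≡ 0 → DV (P₂□C n) v ≡ 1)
    × ((n % 4 ≡ 1 ⊎ n % 4 ≡ 3) → ¬ n ≡ 3 → DV (P₂□C n) v ≡ suc n / 2)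
    × (n % 4 ≡ 2 → ¬ n ≡ 6 → DV (P₂□C n) v ≡ ⌈ suc n /2⌉ ^ 2)
    × (n ≡ 3 → DV (P₂□C n) v ≡ 3)
    × (n ≡ 6 → DV (P₂□C n) v ≡ 17)
theorem4p3 n le v with case n le
-- In each case the implications that do not apply have contradictory hypotheses: residues modulo 4
-- disagree, or an equation for `n` clashes with what the case provides.
... | n≡3 eq dv =
  (λ p → contradiction (trans (sym p) (cong (_% 4) eq)) λ ())
  , (λ _ n≢3 → contradiction eq n≢3)
  , (λ p → contradiction (trans (sym p) (cong (_% 4) eq)) λ ())
  , (λ _ → HasDV.DV≡ dv v)
  , (λ eq′ → contradiction (trans (sym eq) eq′) λ ())
... | n≡6 eq dv =
  (λ p → contradiction (trans (sym p) (cong (_% 4) eq)) λ ())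
  , (λ { (inj₁ p) → contradiction (trans (sym p) (cong (_% 4) eq)) λ ()
       ; (inj₂ p) → contradiction (trans (sym p) (cong (_% 4) eq)) λ () })
  , (λ _ n≢6 → contradiction eq n≢6)
  , (λ eq′ → contradiction (trans (sym eq) eq′) λ ())
  , (λ _ → HasDV.DV≡ dv v)
... | n%4≡0 res dv =
  (λ _ → HasDV.DV≡ dv v)
  , (λ { (inj₁ p) → contradiction (trans (sym res) p) λ ()
       ; (inj₂ p) → contradiction (trans (sym res) p) λ () })
  , (λ p → contradiction (trans (sym res) p) λ ())
  , (λ eq → contradiction (trans (sym res) (cong (_% 4) eq)) λ ())
  , (λ eq → contradiction (trans (sym res) (cong (_% 4) eq)) λ ())
... | odd (inj₁ res) n≢3 dv =
  (λ p → contradiction (trans (sym res) p) λ ())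
  , (λ _ _ → HasDV.DV≡ dv v)
  , (λ p → contradiction (trans (sym res) p) λ ())
  , (λ eq → contradiction eq n≢3)
  , (λ eq → contradiction (trans (sym res) (cong (_% 4) eq)) λ ())
... | odd (inj₂ res) n≢3 dv =
  (λ p → contradiction (trans (sym res) p) λ ())
  , (λ _ _ → HasDV.DV≡ dv v)
  , (λ p → contradiction (trans (sym res) p) λ ())
  , (λ eq → contradiction eq n≢3)
  , (λ eq → contradiction (trans (sym res) (cong (_% 4) eq)) λ ())
... | n%4≡2 res n≢6 dv =
  (λ p → contradiction (trans (sym res) p) λ ())
  , (λ { (inj₁ p) → contradiction (trans (sym res) p) λ ()
       ; (inj₂ p) → contradiction (trans (sym res) p) λ () })
  , (λ _ _ → HasDV.DV≡ dv v)
  , (λ eq → contradiction (trans (sym res) (cong (_% 4) eq)) λ ())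
  , (λ eq → contradiction eq n≢6)
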